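{- Let $\mathcal{T}$ be a nontrivial repcon topology for Scott's graph model $\mathcal{P}(\mathbb{N})$. Then $\mathcal{T}$ contains either the Scott topology or the Alexandroff topology (the topology whose open sets are precisely the subsets of $\mathcal{P}(\mathbb{N})$ that are downward closed with respect to $\subseteq$).
   Context: Scott's graph model is the set $\mathcal{P}(\mathbb{N})$ of subsets of $\mathbb{N}$ with (total) application $A\circ B=\{n\mid \exists m\,([m,n]\in A,\ e_m\subseteq B)\}$, where $[\cdot,\cdot]$ is a standard bijective pairing on $\mathbb{N}$ and $e_k$ is the finite set $p$ with $k=\sum_{i\in p}2^i$. It is a partial combinatory algebra (pca). A partial function $f$ on a pca $\mathcal{A}$ is representable if there is $a_f\in\mathcal{A}$ with $a_fa=f(a)$ for all $a$ in the domain of $f$. A topology on a pca $\mathcal{A}$ is repcon if every partial representable function $\mathcal{A}\to\mathcal{A}$ is continuous on its domain (as subspace of $\mathcal{A}$). The trivial topologies are the discrete and the indiscrete one; nontrivial means neither of these. The Scott topology on $\mathcal{P}(\mathbb{N})$ has as basis the sets $U_p=\{A\subseteq\mathbb{N}\mid p\subseteq A\}$ for finite $p\subseteq\mathbb{N}$. -}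

module Defs where

open import Algebra.Bundles using (Magma)
open import Data.List.Base using (List; []; _++_; map)
import Data.List.Membership.Propositional as List
open import Data.List.Membership.Propositional.Properties using (∈-++⁺ˡ; ∈-++⁺ʳ; ∈-++⁻)
open import Data.List.Relation.Unary.Unique.Propositional using (Unique)
open import Data.Nat.Base using (ℕ; _^_)
open import Data.Nat.ListAction using (sum)
open import Data.Product.Base using (∃-syntax; _×_; _,_; proj₁; proj₂)
open import Data.Sum.Base using (_⊎_; [_,_]′)
open import Function.Bundles using (_⇔_; _⤖_; Bijection)
open import Level using (Level; 0ℓ; suc; _⊔_)
open import Relation.Binary.Bundles using (Setoid)
open import Relation.Binary.Definitions using (_Respects_)
open import Relation.Binary.PropositionalEquality.Core using (_≡_)
open import Relation.Nullary.Negation.Core using (¬_)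
open import Relation.Unary using (Pred; _∈_; _⊆_; _≐_; _∩_; ⋃; Empty; Universal)
open import Relation.Unary.Polymorphic using (∅; U)
open import Relation.Unary.Relation.Binary.Equality using (≐-setoid)

-- Topologies on a setoid, regarded as the set of its equivalence classes: a
-- subset is a predicate that respects _≈_.  Predicates and index sets live
-- at level c ⊔ ℓ; classically every subset and every union of open sets has
-- a representative at that level, since an index set can be taken to consist
-- of the points of the union.

module _ {c ℓ : Level} (S : Setoid c ℓ) where
  open Setoid S using (Carrier; _≈_)

  record Topology (t : Level) : Set (suc (c ⊔ ℓ ⊔ t)) where
    field
      Open       : Pred (Pred Carrier (c ⊔ ℓ)) t
      Open-resp  : Open Respects _≐_
      Open⇒resp  : ∀ {V} → Open V → V Respects _≈_
      ∅-open     : Open ∅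
      U-open     : Open U
      ∩-open     : ∀ {V W} → Open V → Open W → Open (V ∩ W)
      ⋃-open     : (I : Set (c ⊔ ℓ)) (V : I → Pred Carrier (c ⊔ ℓ)) →
                   (∀ i → Open (V i)) → Open (⋃ I V)

  -- A partial function S ⇀ S.

  record PartialFunction : Set (suc (c ⊔ ℓ)) where
    field
      dom      : Pred Carrier (c ⊔ ℓ)
      dom-resp : dom Respects _≈_
      fun      : ∀ x → x ∈ dom → Carrier
      fun-cong : ∀ {x y} (dx : x ∈ dom) (dy : y ∈ dom) →
                 x ≈ y → fun x dx ≈ fun y dy

module _ {c ℓ : Level} {S : Setoid c ℓ} where
  open Setoid S using (Carrier; _≈_)

  Discrete : ∀ {t} → Topology S t → Set (suc (c ⊔ ℓ) ⊔ t)
  Discrete 𝒯 = ∀ (V : Pred Carrier (c ⊔ ℓ)) → V Respects _≈_ → Topology.Open 𝒯 V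

  Indiscrete : ∀ {t} → Topology S t → Set (suc (c ⊔ ℓ) ⊔ t)
  Indiscrete 𝒯 = ∀ V → Topology.Open 𝒯 V → Empty V ⊎ Universal V

  Nontrivial : ∀ {t} → Topology S t → Set (suc (c ⊔ ℓ) ⊔ t)
  Nontrivial 𝒯 = ¬ Discrete 𝒯 × ¬ Indiscrete 𝒯

  Contains : ∀ {t t′} → Topology S t → Topology S t′ → Set (suc (c ⊔ ℓ) ⊔ t ⊔ t′)
  Contains 𝒯 𝒯′ = Topology.Open 𝒯′ ⊆ Topology.Open 𝒯

  -- Continuity for the subspace topology on the domain: the preimage of an
  -- open set is the trace on dom of an open set.

  ContinuousOnDomain : ∀ {t} → Topology S t → PartialFunction S → Set (suc (c ⊔ ℓ) ⊔ t)
  ContinuousOnDomain 𝒯 f =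
    ∀ V → Open V → ∃[ W ] Open W × (∀ x (d : x ∈ dom) → x ∈ W ⇔ fun x d ∈ V)
    where
    open Topology 𝒯 using (Open)
    open PartialFunction f using (dom; fun)

-- Representability and repcon topologies for a pca with total application;
-- only its application (a magma on its underlying setoid) is involved.

module _ {c ℓ : Level} (A : Magma c ℓ) where
  open Magma A using (Carrier; _≈_; _∙_; setoid)

  Representable : PartialFunction setoid → Set (c ⊔ ℓ)
  Representable f = ∃[ a ] (∀ x (d : x ∈ dom) → a ∙ x ≈ fun x d)
    where open PartialFunction f using (dom; fun)

  Repcon : ∀ {t} → Topology setoid t → Set (suc (c ⊔ ℓ) ⊔ t)
  Repcon 𝒯 = ∀ f → Representable f → ContinuousOnDomain 𝒯 f

𝒫ℕ : Set₁
𝒫ℕ = Pred ℕ 0ℓ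

𝒫ℕ-setoid : Setoid (suc 0ℓ) 0ℓ
𝒫ℕ-setoid = ≐-setoid ℕ 0ℓ

-- The finite subset of ℕ enumerated by a list.

⟦_⟧ : List ℕ → 𝒫ℕ
⟦ p ⟧ i = i List.∈ p

-- e k is the finite set p with k = Σ_{i ∈ p} 2^i.  The list p is determined
-- up to order, by uniqueness of binary representation.

e : ℕ → 𝒫ℕ
e k i = ∃[ p ] Unique p × k ≡ sum (map (2 ^_) p) × i ∈ ⟦ p ⟧

module _ (pairing : (ℕ × ℕ) ⤖ ℕ) where

  [_,_]ₚ : ℕ → ℕ → ℕ
  [ m , n ]ₚ = Bijection.to pairing (m , n)

  apply : 𝒫ℕ → 𝒫ℕ → 𝒫ℕ
  apply A B n = ∃[ m ] [ m , n ]ₚ ∈ A × e m ⊆ B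

  graphModel : Magma (suc 0ℓ) 0ℓ
  graphModel = record
    { Carrier = 𝒫ℕ
    ; _≈_     = _≐_
    ; _∙_     = apply
    ; isMagma = record
      { isEquivalence = Setoid.isEquivalence 𝒫ℕ-setoid
      ; ∙-cong        = λ (A⊆A′ , A′⊆A) (B⊆B′ , B′⊆B) →
          (λ (m , a , s) → m , A⊆A′ a , λ i → B⊆B′ (s i)) ,
          (λ (m , a , s) → m , A′⊆A a , λ i → B′⊆B (s i))
      }
    }

-- The basic open sets U_p.

↑_ : List ℕ → Pred 𝒫ℕ 0ℓ
(↑ p) A = ⟦ p ⟧ ⊆ A

scott : Topology 𝒫ℕ-setoid (suc 0ℓ)
scott = record
  { Open      = λ V → ∀ A → A ∈ V → ∃[ p ] A ∈ ↑ p × ↑ p ⊆ V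
  ; Open-resp = λ (V⊆W , W⊆V) o A w → let (p , a , s) = o A (W⊆V w) in
                  p , a , λ {B} b → V⊆W (s {B} b)
  ; Open⇒resp = λ o {A} {B} A≐B v → let (p , a , s) = o A v in
                  s {B} (λ i → proj₁ A≐B (a i))
  ; ∅-open    = λ _ ()
  ; U-open    = λ _ _ → [] , (λ ()) , _
  ; ∩-open    = λ oV oW A (v , w) →
                  let (p , a , s) = oV A v
                      (q , b , r) = oW A w
                  in p ++ q
                   , (λ i → [ a , b ]′ (∈-++⁻ p i))
                   , λ {B} h → s {B} (λ i → h (∈-++⁺ˡ i)) , r {B} (λ i → h (∈-++⁺ʳ p i))
  ; ⋃-open    = λ I V o A (i , v) → let (p , a , s) = o i A v in
                  p , a , λ {B} b → i , s {B} b
  }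

alexandroff : Topology 𝒫ℕ-setoid (suc 0ℓ)
alexandroff = record
  { Open      = λ V → ∀ A B → B ⊆ A → A ∈ V → B ∈ V
  ; Open-resp = λ (V⊆W , W⊆V) o A B s w → V⊆W (o A B s (W⊆V w))
  ; Open⇒resp = λ o {A} {B} A≐B v → o A B (proj₂ A≐B) v
  ; ∅-open    = λ _ _ _ ()
  ; U-open    = λ _ _ _ _ → _
  ; ∩-open    = λ oV oW A B s (v , w) → oV A B s v , oW A B s w
  ; ⋃-open    = λ I V o A B s (i , v) → i , o i A B s v
  }

{-# OPTIONS --safe #-}
module Submission where

open import Defs
open import Axiom.ExcludedMiddle using (ExcludedMiddle)
open import Data.Empty using (⊥-elim)
open import Data.List.Base using (List; []; _∷_; [_]; map)
import Data.List.Membership.Propositional as List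
open import Data.List.Membership.Propositional.Properties using (∈-∃++)
open import Data.List.Relation.Binary.Permutation.Propositional using (_↭_; ↭-sym; ↭⇒↭ₛ)
open import Data.List.Relation.Binary.Permutation.Propositional.Properties using (shift; ∈-resp-↭; map⁺)
import Data.List.Relation.Binary.Permutation.Setoid.Properties as ↭ₛ
open import Data.List.Relation.Unary.All using ([]; lookup)
open import Data.List.Relation.Unary.AllPairs using ([]; _∷_)
open import Data.List.Relation.Unary.Any using (here; there)
open import Data.List.Relation.Unary.Unique.Propositional using (Unique)
open import Data.Nat.Base using (ℕ; zero; suc; _+_; _^_; _≤_; _<_; s≤s⁻¹)
open import Data.Nat.ListAction using (sum)
open import Data.Nat.ListAction.Properties using (sum-↭)
open import Data.Nat.Properties
open import Data.List.Membership.DecPropositional _≟_ using (_∈?_)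
open import Data.Product.Base using (∃-syntax; _×_; _,_; proj₁; proj₂)
open import Data.Sum.Base using (_⊎_; inj₁; inj₂)
open import Data.Unit.Polymorphic using (tt)
open import Function.Bundles using (_⤖_; module Bijection; module Equivalence)
open import Level using (0ℓ; Lift; lift) renaming (suc to lsuc)
open import Relation.Binary.PropositionalEquality using (_≡_; refl; sym; trans; cong; subst; setoid)
open import Relation.Nullary using (¬_; yes; no)
open import Relation.Nullary.Decidable using (decidable-stable)
open import Relation.Unary using (Pred; _∈_; _∉_; _⊆_; _≐_; _≬_; ∁; ｛_｝)
open import Relation.Unary.Polymorphic using (∅; U)
open import Relation.Unary.Properties using (≐-sym)

-- Whether X meets a fixed S ⊆ ℕ is observed by the Scott continuous map sending
-- X to a fixed B if X meets S and to ∅ otherwise.  If an open set contains B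
-- but not ∅, its preimage consists of the X that meet S; for singletons S these
-- are the subbasic Scott opens.  If it contains ∅ but not B, its preimage
-- consists of the X disjoint from S; for S the complement of A this is the
-- down-set of A, and every downward closed set is a union of such.

∈⇒↭∷ : ∀ {a} {A : Set a} {i : A} {p} → i List.∈ p → ∃[ q ] p ↭ i ∷ q
∈⇒↭∷ {i = i} i∈p with ys , zs , refl ← ∈-∃++ i∈p = _ , shift i ys zs

Unique-resp-↭ : ∀ {p q : List ℕ} → p ↭ q → Unique p → Unique q
Unique-resp-↭ p↭q = ↭ₛ.Unique-resp-↭ (setoid ℕ) (↭⇒↭ₛ p↭q)

binary : List ℕ → ℕ
binary p = sum (map (2 ^_) p)

binary-↭ : ∀ {p q} → p ↭ q → binary p ≡ binary q
binary-↭ p↭q = sum-↭ (map⁺ (2 ^_) p↭q)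

2^i≤binary : ∀ {i p} → i List.∈ p → 2 ^ i ≤ binary p
2^i≤binary {p = _ ∷ p} (here refl) = m≤m+n _ (binary p)
2^i≤binary (there i∈p) = m≤n⇒m≤o+n _ (2^i≤binary i∈p)

-- Induction on `i`: by uniqueness the top exponent occurs at most once, and the exponents below it
-- contribute less than that one power, so the total stays below its double.
binary<2^ : ∀ i {p} → Unique p → (∀ {j} → j List.∈ p → j < i) → binary p < 2 ^ i
binary<2^ zero {[]} u p<i = ≤-refl
binary<2^ zero {_ ∷ _} u p<i with () ← p<i (here refl)
binary<2^ (suc i) {p} u p<1+i with i ∈? p
... | no i∉p = <-≤-trans
  (binary<2^ i u λ j∈p → ≤∧≢⇒< (s≤s⁻¹ (p<1+i j∈p)) λ { refl → i∉p j∈p })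
  (m≤m+n (2 ^ i) _)
... | yes i∈p
  with q , p↭i∷q ← ∈⇒↭∷ i∈p
  with i≢q ∷ uq ← Unique-resp-↭ p↭i∷q u = begin-strict
    binary p          ≡⟨ binary-↭ p↭i∷q ⟩
    2 ^ i + binary q  <⟨ +-monoʳ-< (2 ^ i) (binary<2^ i uq λ j∈q →
                           ≤∧≢⇒< (s≤s⁻¹ (p<1+i (∈-resp-↭ (↭-sym p↭i∷q) (there j∈q))))
                                 λ { refl → lookup i≢q j∈q refl }) ⟩
    2 ^ i + 2 ^ i     ≡⟨ cong (2 ^ i +_) (+-identityʳ (2 ^ i)) ⟨
    2 ^ suc i         ∎
  where open ≤-Reasoning

-- An exponent above `i` would alone exceed the sum, and exponents all below `i` fall short of it by
-- `binary<2^`. So `i` occurs in `p`, and it already uses up the whole sum.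
binary≡2^ : ∀ {i j p} → Unique p → 2 ^ i ≡ binary p → j List.∈ p → i ≡ j
binary≡2^ {i} {j} {p} u eq j∈p with i ∈? p
... | no i∉p = ⊥-elim (<-irrefl (sym eq) (binary<2^ i u λ {k} k∈p →
    ≤∧≢⇒< (≮⇒≥ λ i<k → <⇒≱ (^-monoʳ-< 2 ≤-refl i<k)
                             (subst (2 ^ k ≤_) (sym eq) (2^i≤binary k∈p)))
          λ { refl → i∉p k∈p }))
... | yes i∈p with q , p↭i∷q ← ∈⇒↭∷ i∈p with ∈-resp-↭ p↭i∷q j∈p
...   | here j≡i  = sym j≡i
...   | there j∈q = ⊥-elim (<⇒≱ (m^n>0 2 j) (subst (2 ^ j ≤_) binary-q≡0 (2^i≤binary j∈q)))
  where
  binary-q≡0 : binary q ≡ 0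
  binary-q≡0 = +-cancelˡ-≡ (2 ^ i) _ _
    (trans (sym (trans eq (binary-↭ p↭i∷q))) (sym (+-identityʳ (2 ^ i))))

-- Codes of singletons let application test its argument for a single element.
e-2^ : ∀ i → e (2 ^ i) ≐ ｛ i ｝
e-2^ i = (λ (p , u , eq , j∈p) → binary≡2^ u eq j∈p)
       , λ { refl → [ i ] , [] ∷ [] , sym (+-identityʳ (2 ^ i)) , here refl }

-- The conditional is a conjunction, with no case distinction on `S ≬ X`, so representability needs
-- no excluded middle.
ifMeets : 𝒫ℕ → 𝒫ℕ → 𝒫ℕ → 𝒫ℕ
ifMeets S B X n = S ≬ X × n ∈ B

ifMeets-≬ : ∀ {S X} B → S ≬ X → ifMeets S B X ≐ B
ifMeets-≬ B S≬X = proj₂ , (S≬X ,_)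

ifMeets-¬≬ : ∀ {S X} B → ¬ S ≬ X → ifMeets S B X ≐ ∅ {ℓ = 0ℓ}
ifMeets-¬≬ B ¬S≬X = (λ (S≬X , _) → ⊥-elim (¬S≬X S≬X)) , λ ()

ifMeetsFunction : 𝒫ℕ → 𝒫ℕ → PartialFunction 𝒫ℕ-setoid
ifMeetsFunction S B = record
  { dom      = U
  ; dom-resp = λ _ _ → tt
  ; fun      = λ X _ → ifMeets S B X
  ; fun-cong = λ _ _ (X⊆Y , Y⊆X) →
      (λ ((i , i∈S , i∈X) , b) → (i , i∈S , X⊆Y i∈X) , b) ,
      (λ ((i , i∈S , i∈Y) , b) → (i , i∈S , Y⊆X i∈Y) , b)
  }

-- A single element of `S` found in `X` releases all of `B`, so a graph whose premises are
-- singletons suffices.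
ifMeets-representable : ∀ pairing S B → Representable (graphModel pairing) (ifMeetsFunction S B)
ifMeets-representable pairing S B = code , λ X _ → to X , from X
  where
  code : 𝒫ℕ
  code k = ∃[ i ] ∃[ n ] k ≡ [_,_]ₚ pairing (2 ^ i) n × i ∈ S × n ∈ B

  to : ∀ X → apply pairing code X ⊆ ifMeets S B X
  to X (m , (i , n , eq , i∈S , n∈B) , e⊆X)
    with refl ← Bijection.injective pairing eq
    = (i , i∈S , e⊆X (proj₂ (e-2^ i) refl)) , n∈B

  from : ∀ X → ifMeets S B X ⊆ apply pairing code X
  from X ((i , i∈S , i∈X) , n∈B)
    = 2 ^ i , (i , _ , refl , i∈S , n∈B)
    , λ j∈e → subst (_∈ X) (proj₁ (e-2^ i) j∈e) i∈X

module _ (em : ∀ {ℓ} → ExcludedMiddle ℓ) (pairing : (ℕ × ℕ) ⤖ ℕ)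
         {t} (𝒯 : Topology 𝒫ℕ-setoid t) (repcon : Repcon (graphModel pairing) 𝒯) where
  open Topology 𝒯

  ∁-stable : ∀ {a ℓ} {A : Set a} (P : Pred A ℓ) → ∁ (∁ P) ⊆ P
  ∁-stable P = decidable-stable em

  -- The map is total, so the `W` supplied by `repcon` is the full preimage of `V`. `Lift` raises
  -- the predicate to the universe level of open sets.
  meeting-open : ∀ {V} → Open V → ∅ ∉ V → ∀ {B} → B ∈ V →
                 ∀ S → Open (λ X → Lift (lsuc 0ℓ) (S ≬ X))
  meeting-open {V} oV ∅∉V {B} B∈V S
    with W , oW , W⇔ ← repcon (ifMeetsFunction S B) (ifMeets-representable pairing S B) V oV
    = Open-resp
      -- If `X` missed `S`, its image would be `∅`, which is not in `V`; this refutes `¬ S ≬ X`, and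
      -- excluded middle does the rest.
      ( (λ {X} X∈W → lift (∁-stable (S ≬_) λ ¬S≬X →
            ∅∉V (Open⇒resp oV (ifMeets-¬≬ B ¬S≬X) (Equivalence.to (W⇔ X tt) X∈W))))
      , λ {X} (lift S≬X) →
            Equivalence.from (W⇔ X tt) (Open⇒resp oV (≐-sym (ifMeets-≬ B S≬X)) B∈V)
      ) oW

  -- The same preimage, with the roles of `∅` and `B` exchanged.
  disjoint-open : ∀ {V} → Open V → ∅ ∈ V → ∀ {B} → B ∉ V →
                  ∀ S → Open (λ X → Lift (lsuc 0ℓ) (¬ S ≬ X))
  disjoint-open {V} oV ∅∈V {B} B∉V S
    with W , oW , W⇔ ← repcon (ifMeetsFunction S B) (ifMeets-representable pairing S B) V oV
    = Open-resp
      ( (λ {X} X∈W → lift λ S≬X →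
            B∉V (Open⇒resp oV (ifMeets-≬ B S≬X) (Equivalence.to (W⇔ X tt) X∈W)))
      , λ {X} (lift ¬S≬X) →
            Equivalence.from (W⇔ X tt) (Open⇒resp oV (≐-sym (ifMeets-¬≬ B ¬S≬X)) ∅∈V)
      ) oW

  contains-scott : ∀ {V} → Open V → ∅ ∉ V → ∀ {B} → B ∈ V → Contains 𝒯 scott
  contains-scott oV ∅∉V B∈V {G} scott-G = Open-resp
    ( (λ ((p , ↑p⊆G) , lift p⊆A) → ↑p⊆G p⊆A)
    , λ {A} A∈G → let (p , A∈↑p , ↑p⊆G) = scott-G A A∈G in
        (p , λ {B} → ↑p⊆G {B}) , lift (λ {i} → A∈↑p {i})
    -- `G` is the union of all basic sets that it includes.
    ) (⋃-open (∃[ p ] ↑ p ⊆ G) _ λ (p , _) → ↑-open p)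
    where
    -- A finite intersection of subbasic sets, one for each entry of `p`; the empty list gives the
    -- whole space.
    ↑-open : ∀ p → Open (λ A → Lift (lsuc 0ℓ) (A ∈ ↑ p))
    ↑-open [] = Open-resp ((λ _ → lift λ ()) , _) U-open
    ↑-open (i ∷ p) = Open-resp
      ( (λ { (lift (_ , refl , i∈A) , lift p⊆A) →
             lift λ { (here refl) → i∈A ; (there j∈p) → p⊆A j∈p } })
      , λ (lift i∷p⊆A) → lift (i , refl , i∷p⊆A (here refl)) , lift λ j∈p → i∷p⊆A (there j∈p)
      ) (∩-open (meeting-open oV ∅∉V B∈V ｛ i ｝) (↑-open p))

  contains-alexandroff : ∀ {V} → Open V → ∅ ∈ V → ∀ {B} → B ∉ V → Contains 𝒯 alexandroff
  contains-alexandroff oV ∅∈V B∉V {G} down-G = Open-resp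
    ( (λ {X} ((A , A∈G) , lift ¬∁A≬X) →
         -- Disjointness from `∁ A` only makes `i ∉ A` absurd for `i ∈ X`; excluded middle turns
         -- this into `X ⊆ A`.
         down-G A X (λ {i} i∈X → ∁-stable A λ i∉A → ¬∁A≬X (i , i∉A , i∈X)) A∈G)
    , λ {X} X∈G → (X , X∈G) , lift λ (i , i∉X , i∈X) → i∉X i∈X
    ) (⋃-open (∃[ A ] A ∈ G) _ λ (A , _) → disjoint-open oV ∅∈V B∉V (∁ A))

lemma2p1 : (∀ {ℓ} → ExcludedMiddle ℓ) →
    (pairing : (ℕ × ℕ) ⤖ ℕ) →
    ∀ {t} (𝒯 : Topology 𝒫ℕ-setoid t) →
    Nontrivial 𝒯 → Repcon (graphModel pairing) 𝒯 →
    Contains 𝒯 scott ⊎ Contains 𝒯 alexandroff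
lemma2p1 em pairing 𝒯 (_ , ¬indiscrete) repcon
  -- An open set that is neither empty nor everything separates `∅` from some `B`, in one of two
  -- directions.
  with em {P = ∃[ V ] Topology.Open 𝒯 V × ∅ ∉ V × ∃[ B ] B ∈ V}
     | em {P = ∃[ V ] Topology.Open 𝒯 V × ∅ ∈ V × ∃[ B ] B ∉ V}
... | yes (_ , oV , ∅∉V , _ , B∈V) | _ =
  inj₁ (contains-scott em pairing 𝒯 repcon oV ∅∉V B∈V)
... | no _ | yes (_ , oV , ∅∈V , _ , B∉V) =
  inj₂ (contains-alexandroff em pairing 𝒯 repcon oV ∅∈V B∉V)
... | no ¬up | no ¬down = ⊥-elim (¬indiscrete indiscrete)
  where
  indiscrete : Indiscrete 𝒯
  -- With no separation in either direction, every point lies in `V` exactly when `∅` does.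
  indiscrete V oV with em {P = ∅ ∈ V}
  ... | yes ∅∈V = inj₂ λ B → decidable-stable em λ B∉V → ¬down (V , oV , ∅∈V , B , B∉V)
  ... | no ∅∉V  = inj₁ λ B B∈V → ¬up (V , oV , ∅∉V , B , B∈V)
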